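{- Let $\mathcal{C}$ be a reduced $(m,n,r)$-scheme and $p$ a prime. (i) If $m<2r$, then $n=1$. (ii) If $p\nmid m$ and the homogeneous component $\mathcal{C}_X$ is $p$-valenced for some $X\in\mathrm{Fib}(\mathcal{C})$, then $n=1$.
   Context: A scheme is a pair $\mathcal{C}=(V,\mathcal{R})$, $V$ finite, $\mathcal{R}$ a partition of $V\times V$ into nonempty relations such that $\Delta_V$ is a union of members of $\mathcal{R}$, $\mathcal{R}$ is closed under transposition, and for $R,S,T\in\mathcal{R}$ the number of $w$ with $(u,w)\in R,(w,v)\in S$ is the same for all $(u,v)\in T$. A fiber is a nonempty $X\subseteq V$ with $\Delta_X\in\mathcal{R}$; $\mathrm{Fib}(\mathcal{C})$ is the set of fibers; $\mathcal{R}_{X,Y}=\{R\in\mathcal{R}:R\subseteq X\times Y\}$, $\mathcal{R}_X=\mathcal{R}_{X,X}$, and $\mathcal{C}_X=(X,\mathcal{R}_X)$. An $(m,n,r)$-scheme is one with $|\mathcal{R}_{X,Y}|=r$ for all fibers $X,Y$, $|X|=m$ for all fibers, and $|\mathrm{Fib}(\mathcal{C})|=n$. For $R\in\mathcal{R}_{X,Y}$, its degree $d_R$ is $|\{y:(x,y)\in R\}|$ for any $x\in X$ (independent of $x$). A basis relation is thin if $|\{y:(x,y)\in R\}|=|\{x:(x,y)\in R\}|=1$. The relation $E_\mathcal{C}=\{(X,Y): \exists R\in\mathcal{R}_{X,Y}\text{ thin}\}$ is an equivalence relation on $\mathrm{Fib}(\mathcal{C})$; the scheme is reduced if $E_\mathcal{C}$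 is the equality relation. For a prime $p$, $\mathcal{C}_X$ is $p$-valenced if every basis relation in $\mathcal{R}_X$ has degree a power of $p$. -}

module Defs where

import Level
open import Data.Nat using (ℕ; _<_; _^_)
open import Data.Fin using (Fin; _≟_)
open import Data.Fin.Properties using (all?)
open import Data.List using (length; filter; allFin)
open import Data.Product using (Σ; ∃; _×_; _,_)
open import Relation.Nullary using (Dec; ¬_)
open import Relation.Nullary.Decidable using (_×-dec_; _→-dec_)
open import Relation.Unary using (Pred; Decidable)
open import Relation.Binary.PropositionalEquality using (_≡_)

count : ∀ {n} {P : Pred (Fin n) Level.zero} → Decidable P → ℕ
count {n} P? = length (filter P? (allFin n))

-- A partition of V × V (V = Fin N) into k relations is encoded by the
-- colouring col : V → V → Fin k; relation j is { (u,v) | col u v ≡ j }.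
record Scheme : Set where
  field
    N   : ℕ
    k   : ℕ
    col : Fin N → Fin N → Fin k
    nonempty : ∀ (j : Fin k) → ∃ λ u → ∃ λ v → col u v ≡ j
    -- Δ_V is a union of relations: a relation meeting Δ_V lies inside Δ_V
    diag : ∀ u v w → col u u ≡ col v w → v ≡ w
    transp : ∀ u v u′ v′ → col u v ≡ col u′ v′ → col v u ≡ col v′ u′
    coherent : ∀ (R S : Fin k) u v u′ v′ → col u v ≡ col u′ v′ →
      count (λ w → (col u w ≟ R) ×-dec (col w v ≟ S))
        ≡ count (λ w → (col u′ w ≟ R) ×-dec (col w v′ ≟ S))

module _ (C : Scheme) where
  open Scheme C

  -- relation i is Δ_X for the fiber X = { u | col u u ≡ i } (nonempty by `nonempty`)
  IsFiber : Fin k → Set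
  IsFiber i = ∀ u v → col u v ≡ i → u ≡ v

  isFiber? : Decidable IsFiber
  isFiber? i = all? λ u → all? λ v → (col u v ≟ i) →-dec (u ≟ v)

  _∈F_ : Fin N → Fin k → Set
  u ∈F X = col u u ≡ X

  InRel : Fin k → Fin k → Fin k → Set
  InRel X Y j = ∀ u v → col u v ≡ j → (u ∈F X) × (v ∈F Y)

  inRel? : ∀ X Y → Decidable (InRel X Y)
  inRel? X Y j = all? λ u → all? λ v →
    (col u v ≟ j) →-dec ((col u u ≟ X) ×-dec (col v v ≟ Y))

  outdeg : Fin k → Fin N → ℕ
  outdeg j x = count (λ y → col x y ≟ j)

  indeg : Fin k → Fin N → ℕ
  indeg j y = count (λ x → col x y ≟ j)

  Thin : Fin k → Fin k → Fin k → Set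
  Thin X Y j = (∀ x → x ∈F X → outdeg j x ≡ 1) × (∀ y → y ∈F Y → indeg j y ≡ 1)

  Reduced : Set
  Reduced = ∀ X Y → IsFiber X → IsFiber Y →
    (∃ λ j → InRel X Y j × Thin X Y j) → X ≡ Y

  IsMNR : ℕ → ℕ → ℕ → Set
  IsMNR m n r =
      (∀ X Y → IsFiber X → IsFiber Y → count (inRel? X Y) ≡ r)
    × (∀ X → IsFiber X → count (λ u → col u u ≟ X) ≡ m)
    × (count isFiber? ≡ n)

  Valenced : ℕ → Fin k → Set
  Valenced p X = ∀ j → InRel X X j → ∀ x → x ∈F X → ∃ λ e → outdeg j x ≡ p ^ e

{-# OPTIONS --safe #-}

-- Since all fibers have m points, a relation of degree 1 between two fibers X, Y
-- is thin; so for X ≠ Y every degree in R_{X,Y} is at least 2.  The r degrees add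
-- up to m, which gives (i).  For (ii), some R in R_{X,Y} has degree prime to p.  If
-- x, x′ are in X and T = r(x,x′), then  d_T |xR ∩ x′V| = d_R c  with d_T a power of p,
-- so d_R divides |xR ∩ x′V| ≤ d_R:  xR lies inside a single x′V.  Hence every T R
-- with T in R_X is a single relation, and T ↦ T R maps R_X onto R_{X,Y}.  Both sets
-- have r elements, so the map is injective.  Points a, a′ of X with a common
-- R-neighbour satisfy  r(a,a′) R = R = Δ_X R,  hence a = a′, and R is thin.

module Submission where

open import Defs
import Level
open import Data.Bool using (true; false; if_then_else_)
open import Data.Fin using (Fin; zero; suc; _≟_; fromℕ<)
open import Data.Fin.Properties using (any?; ¬∀⟶∃¬)
open import Data.List using (List; []; _∷_; length; filter; allFin; tabulate)
open import Data.List.Membership.Propositional using (lose)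
open import Data.List.Membership.Propositional.Properties using (∈-allFin)
open import Data.List.Properties using (filter-some; filter-none; filter-≐)
open import Data.List.Relation.Unary.All as All using (All; []; _∷_)
open import Data.List.Relation.Unary.All.Properties using (all-filter)
open import Data.List.Relation.Unary.AllPairs using ([]; _∷_)
open import Data.List.Relation.Unary.Unique.Propositional using (Unique)
import Data.List.Relation.Unary.Unique.Propositional.Properties as Unique
open import Data.Nat using (ℕ; zero; suc; _*_; _^_; _≤_; _<_; z≤n; s≤s; >-nonZero)
open import Data.Nat.Coprimality using (Coprime; coprime-divisor)
open import Data.Nat.Divisibility using (_∣_; _∣?_; divides; ∣m∣n⇒∣m+n; ∣n⇒∣m*n; _∣0; ∣⇒≤)
open import Data.Nat.Primality using (Prime; prime⇒irreducible)
open import Data.Nat.Properties hiding (_≟_)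
open import Data.Product using (∃; _×_; _,_; proj₁; proj₂)
open import Data.Sum using (inj₁; inj₂)
open import Function using (_∘_; id)
open import Relation.Nullary using (Dec; yes; no; ¬_; contradiction)
open import Relation.Nullary.Decidable using (does; _×-dec_; _→-dec_; ¬?; decidable-stable)
open import Relation.Unary using (Pred; Decidable; _≐_; _⊆_)
open import Relation.Binary.PropositionalEquality
  using (_≡_; _≢_; refl; sym; trans; cong; subst; module ≡-Reasoning)
open import Algebra.Properties.Semiring.Sum +-*-semiring
  using (sum; sum-syntax; sum-cong-≗; ∑-comm; *-distribˡ-sum; *-distribʳ-sum)

-- Counting

ind : {A : Set} → Dec A → ℕ
ind a? = if does a? then 1 else 0

ind-×-dec : ∀ {A B : Set} (a? : Dec A) (b? : Dec B) → ind (a? ×-dec b?) ≡ ind a? * ind b?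
ind-×-dec a? b? with does a? | does b?
... | false | _     = refl
... | true  | false = refl
... | true  | true  = refl

sum-mono-≤ : ∀ {n} {f g : Fin n → ℕ} → (∀ i → f i ≤ g i) → sum f ≤ sum g
sum-mono-≤ {zero}  f≤g = z≤n
sum-mono-≤ {suc n} f≤g = +-mono-≤ (f≤g zero) (sum-mono-≤ (f≤g ∘ suc))

sum-mono-< : ∀ {n} {f g : Fin n → ℕ} → (∀ i → f i ≤ g i) → ∀ i → f i < g i → sum f < sum g
sum-mono-< f≤g zero    f<g = +-mono-<-≤ f<g (sum-mono-≤ (f≤g ∘ suc))
sum-mono-< f≤g (suc i) f<g = +-mono-≤-< (f≤g zero) (sum-mono-< (f≤g ∘ suc) i f<g)

∣-sum : ∀ {n d} {f : Fin n → ℕ} → (∀ i → d ∣ f i) → d ∣ sum f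
∣-sum {zero}  d∣f = _ ∣0
∣-sum {suc n} d∣f = ∣m∣n⇒∣m+n (d∣f zero) (∣-sum (d∣f ∘ suc))

private variable
  m n : ℕ
  P Q : Pred (Fin n) Level.zero

count-sum : (P? : Decidable P) → count P? ≡ ∑[ i < n ] ind (P? i)
count-sum {n} {P} P? = go n id
  where
  go : ∀ l (f : Fin l → Fin n) → length (filter P? (tabulate f)) ≡ ∑[ i < l ] ind (P? (f i))
  go zero    f = refl
  go (suc l) f with does (P? (f zero))
  ... | false = go l (f ∘ suc)
  ... | true  = cong suc (go l (f ∘ suc))

count-cong : (P? : Decidable P) (Q? : Decidable Q) → P ≐ Q → count P? ≡ count Q?
count-cong P? Q? P≐Q = cong length (filter-≐ P? Q? P≐Q (allFin _))

count-pos : (P? : Decidable P) → ∃ P → 0 < count P?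
count-pos P? (i , pi) = filter-some P? (lose (∈-allFin i) pi)

count-pos⁻¹ : (P? : Decidable P) → 0 < count P? → ∃ P
count-pos⁻¹ P? 0<c with any? P?
... | yes ∃P = ∃P
... | no ¬∃P = contradiction (cong length (filter-none P? (All.universal (λ i pi → ¬∃P (i , pi)) (allFin _))))
                             (>⇒≢ 0<c)

count≤1 : (P? : Decidable P) → (∀ i j → P i → P j → i ≡ j) → count P? ≤ 1
count≤1 {n} {P} P? unique = go _ (Unique.filter⁺ P? (Unique.allFin⁺ n)) (all-filter P? (allFin n))
  where
  go : ∀ is → Unique is → All P is → length is ≤ 1
  go []          _                  _                = z≤n
  go (i ∷ [])    _                  _                = s≤s z≤n
  go (i ∷ j ∷ _) ((i≢j ∷ _) ∷ _) (pi ∷ pj ∷ _) = contradiction (unique i j pi pj) i≢j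

-- Weighting by an indicator keeps the index range all of `Fin n`, so `∑-comm` and the distributive
-- laws apply.
∑∈ : {P : Pred (Fin n) Level.zero} → Decidable P → (Fin n → ℕ) → ℕ
∑∈ {n} P? f = ∑[ i < n ] (ind (P? i) * f i)

∑∈-mono-≤ : (P? : Decidable P) {f g : Fin n → ℕ} → (∀ i → P i → f i ≤ g i) → ∑∈ P? f ≤ ∑∈ P? g
∑∈-mono-≤ P? {f} {g} f≤g = sum-mono-≤ term
  where
  term : ∀ i → ind (P? i) * f i ≤ ind (P? i) * g i
  term i with P? i
  ... | yes pi = *-monoʳ-≤ 1 (f≤g i pi)
  ... | no  _  = z≤n

∑∈-const : (P? : Decidable P) (c : ℕ) → ∑∈ P? (λ _ → c) ≡ count P? * c
∑∈-const P? c = trans (sym (*-distribʳ-sum c (ind ∘ P?))) (cong (_* c) (sym (count-sum P?)))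

∑∈-≡ : (P? : Decidable P) {f : Fin n → ℕ} {c : ℕ} → (∀ i → P i → f i ≡ c) → ∑∈ P? f ≡ count P? * c
∑∈-≡ P? {c = c} f≡c = trans
  (≤-antisym (∑∈-mono-≤ P? λ i pi → ≤-reflexive (f≡c i pi))
             (∑∈-mono-≤ P? λ i pi → ≤-reflexive (sym (f≡c i pi))))
  (∑∈-const P? c)

∣-∑∈ : (P? : Decidable P) {f : Fin n → ℕ} {d : ℕ} → (∀ i → P i → d ∣ f i) → d ∣ ∑∈ P? f
∣-∑∈ P? {f} {d} d∣f = ∣-sum term
  where
  term : ∀ i → d ∣ ind (P? i) * f i
  term i with P? i
  ... | yes pi = ∣n⇒∣m*n 1 (d∣f i pi)
  ... | no  _  = d ∣0

-- Double counting of a relation between two finite sets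

module _ {P : Pred (Fin m) Level.zero} {Q : Pred (Fin n) Level.zero} {W : Fin m → Fin n → Set}
         (P? : Decidable P) (Q? : Decidable Q) (W? : ∀ i j → Dec (W i j)) where

  -- Both sides count the pairs `(i , j)` of `W` with `i` in `P` and `j` in `Q`, by rows and by
  -- columns.
  ∑∈-swap : ∑∈ P? (λ i → count (λ j → Q? j ×-dec W? i j))
          ≡ ∑∈ Q? (λ j → count (λ i → P? i ×-dec W? i j))
  ∑∈-swap = begin
    ∑[ i < m ] (p i * count (λ j → Q? j ×-dec W? i j))   ≡⟨ sum-cong-≗ (λ i → cong (p i *_) (expand Q? (W? i))) ⟩
    ∑[ i < m ] (p i * ∑[ j < n ] (q j * w i j))          ≡⟨ sum-cong-≗ (λ i → *-distribˡ-sum (p i) (λ j → q j * w i j)) ⟩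
    ∑[ i < m ] ∑[ j < n ] (p i * (q j * w i j))          ≡⟨ ∑-comm (λ i j → p i * (q j * w i j)) ⟩
    ∑[ j < n ] ∑[ i < m ] (p i * (q j * w i j))          ≡⟨ sum-cong-≗ (λ j → sum-cong-≗ (λ i → exchange (p i) (q j) (w i j))) ⟩
    ∑[ j < n ] ∑[ i < m ] (q j * (p i * w i j))          ≡⟨ sum-cong-≗ (λ j → *-distribˡ-sum (q j) (λ i → p i * w i j)) ⟨
    ∑[ j < n ] (q j * ∑[ i < m ] (p i * w i j))          ≡⟨ sum-cong-≗ (λ j → cong (q j *_) (expand P? (λ i → W? i j))) ⟨
    ∑[ j < n ] (q j * count (λ i → P? i ×-dec W? i j))   ∎
    where
    open ≡-Reasoning
    p = λ i → ind (P? i)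
    q = λ j → ind (Q? j)
    w = λ i j → ind (W? i j)
    expand : ∀ {l} {A B : Pred (Fin l) Level.zero} (A? : Decidable A) (B? : Decidable B) →
             count (λ i → A? i ×-dec B? i) ≡ ∑[ i < l ] (ind (A? i) * ind (B? i))
    expand A? B? = trans (count-sum (λ i → A? i ×-dec B? i)) (sum-cong-≗ λ i → ind-×-dec (A? i) (B? i))
    exchange : ∀ a b c → a * (b * c) ≡ b * (a * c)
    exchange a b c = trans (sym (*-assoc a b c)) (trans (cong (_* c) (*-comm a b)) (*-assoc b a c))

  double-count : ∀ {c d} →
    (∀ i → P i → count (λ j → Q? j ×-dec W? i j) ≡ c) →
    (∀ j → Q j → count (λ i → P? i ×-dec W? i j) ≡ d) →
    count P? * c ≡ count Q? * d
  double-count rows columns = trans (sym (∑∈-≡ P? rows)) (trans ∑∈-swap (∑∈-≡ Q? columns))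

  -- In the count of related pairs every column contributes at least 1 and every row at most 1.
  surjective⇒count≤ : (∀ j → Q j → ∃ λ i → P i × W i j) →
    (∀ i j j′ → P i → W i j → W i j′ → j ≡ j′) → count Q? ≤ count P?
  surjective⇒count≤ onto functional = begin
    count Q?                                         ≡⟨ *-identityʳ _ ⟨
    count Q? * 1                                     ≡⟨ ∑∈-const Q? 1 ⟨
    ∑∈ Q? (λ _ → 1)                                  ≤⟨ ∑∈-mono-≤ Q? (λ j qj → count-pos (λ i → P? i ×-dec W? i j) (onto j qj)) ⟩
    ∑∈ Q? (λ j → count (λ i → P? i ×-dec W? i j))    ≡⟨ ∑∈-swap ⟨
    ∑∈ P? (λ i → count (λ j → Q? j ×-dec W? i j))    ≤⟨ ∑∈-mono-≤ P? (λ i pi → count≤1 (λ j → Q? j ×-dec W? i j)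
                                                          λ j j′ (_ , wj) (_ , wj′) → functional i j j′ pi wj wj′) ⟩
    ∑∈ P? (λ _ → 1)                                  ≡⟨ ∑∈-const P? 1 ⟩
    count P? * 1                                     ≡⟨ *-identityʳ _ ⟩
    count P?                                         ∎
    where open ≤-Reasoning

count-mono-≤ : (P? : Decidable P) (Q? : Decidable Q) → P ⊆ Q → count P? ≤ count Q?
count-mono-≤ P? Q? P⊆Q = surjective⇒count≤ Q? P? (λ i j → i ≟ j)
  (λ j pj → j , P⊆Q pj , refl) (λ _ _ _ _ i≡j i≡j′ → trans (sym i≡j) i≡j′)

count-mono-< : (P? : Decidable P) (Q? : Decidable Q) → P ⊆ Q → ∀ {i} → Q i → ¬ P i → count P? < count Q?
count-mono-< P? Q? P⊆Q {i} qi ¬pi = begin-strict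
  count P?              ≡⟨ count-sum P? ⟩
  sum (ind ∘ P?)        <⟨ sum-mono-< (λ j → term (P? j) (Q? j) P⊆Q) i (term-< (P? i) (Q? i)) ⟩
  sum (ind ∘ Q?)        ≡⟨ count-sum Q? ⟨
  count Q?              ∎
  where
  open ≤-Reasoning
  term : ∀ {A B : Set} (a? : Dec A) (b? : Dec B) → (A → B) → ind a? ≤ ind b?
  term (yes a) (yes _) _ = ≤-refl
  term (yes a) (no ¬b) f = contradiction (f a) ¬b
  term (no _)  _       _ = z≤n
  term-< : (p? : Dec _) (q? : Dec _) → ind p? < ind q?
  term-< (yes pi) _       = contradiction pi ¬pi
  term-< (no _) (yes _)   = s≤s z≤n
  term-< (no _) (no ¬qi)  = contradiction qi ¬qi

count-≤⇒⊇ : (P? : Decidable P) (Q? : Decidable Q) → P ⊆ Q → count Q? ≤ count P? → Q ⊆ P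
count-≤⇒⊇ P? Q? P⊆Q #Q≤#P {i} qi =
  decidable-stable (P? i) λ ¬pi → <⇒≱ (count-mono-< P? Q? P⊆Q qi ¬pi) #Q≤#P

-- If `i` and `i′` were distinct with the same image, deleting `i` would leave a surjection from a
-- set strictly smaller than `Q`.
surjective⇒injective : ∀ {P : Pred (Fin m) Level.zero} {Q : Pred (Fin n) Level.zero} {W : Fin m → Fin n → Set}
  (P? : Decidable P) (Q? : Decidable Q) (W? : ∀ i j → Dec (W i j)) → count P? ≡ count Q? →
  (∀ j → Q j → ∃ λ i → P i × W i j) →
  (∀ i j j′ → P i → W i j → W i j′ → j ≡ j′) →
  ∀ i i′ j → P i → P i′ → W i j → W i′ j → i ≡ i′
surjective⇒injective {P = P} {Q} {W} P? Q? W? #P≡#Q onto functional i i′ j pi pi′ wi wi′ =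
  decidable-stable (i ≟ i′) λ i≢i′ →
    <⇒≱ (count-mono-< P-i? P? proj₁ pi λ (_ , i≢i) → i≢i refl)
        (≤-trans (≤-reflexive #P≡#Q)
                 (surjective⇒count≤ P-i? Q? W? (onto-i i≢i′) λ l _ _ (pl , _) → functional l _ _ pl))
  where
  P-i? : Decidable (λ l → P l × l ≢ i)
  P-i? l = P? l ×-dec ¬? (l ≟ i)
  onto-i : i ≢ i′ → ∀ j → Q j → ∃ λ l → (P l × l ≢ i) × W l j
  onto-i i≢i′ j′ qj′ with onto j′ qj′
  ... | l , pl , wl with l ≟ i
  ...   | no l≢i   = l , (pl , l≢i) , wl
  -- The only image of the deleted `i` is `j`, and `i′` still reaches it.
  ...   | yes refl = i′ , (pi′ , i≢i′ ∘ sym) , subst (W i′) (functional i j j′ pi wi wl) wi′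

-- Irreducibility of `p` makes `d` coprime to `p`, so the factors `p` can be cancelled one at a
-- time.
coprime-prime-power : ∀ {p d} → Prime p → ¬ p ∣ d → ∀ e {c} → d ∣ p ^ e * c → d ∣ c
coprime-prime-power {p} {d} pp p∤d = go
  where
  d⊥p : Coprime d p
  d⊥p (q∣d , q∣p) with prime⇒irreducible pp q∣p
  ... | inj₁ q≡1 = q≡1
  ... | inj₂ q≡p = contradiction (subst (_∣ d) q≡p q∣d) p∤d
  go : ∀ e {c} → d ∣ p ^ e * c → d ∣ c
  go zero    {c} d∣c  = subst (d ∣_) (*-identityˡ c) d∣c
  go (suc e) {c} d∣pc = go e (coprime-divisor d⊥p (subst (d ∣_) (*-assoc p (p ^ e) c) d∣pc))

-- Coherent configurations

module _ (C : Scheme) where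
  open Scheme C

  -- The point `w` makes an intersection number positive at `(u , v)`; coherence makes it positive
  -- at `(u′ , v′)` too.
  transport-path : ∀ {u v u′ v′} → col u v ≡ col u′ v′ → ∀ w →
    ∃ λ w′ → col u′ w′ ≡ col u w × col w′ v′ ≡ col w v
  transport-path {u} {v} {u′} {v′} uv≡ w =
    count-pos⁻¹ (λ z → (col u′ z ≟ col u w) ×-dec (col z v′ ≟ col w v))
      (subst (0 <_) (coherent (col u w) (col w v) u v u′ v′ uv≡)
        (count-pos (λ z → (col u z ≟ col u w) ×-dec (col z v ≟ col w v)) (w , refl , refl)))

  source : ∀ {u v u′ v′} → col u v ≡ col u′ v′ → col u u ≡ col u′ u′
  source {u} {u′ = u′} uv≡ with transport-path uv≡ u
  -- The path u, u, v has been transported. Its first edge keeps a diagonal colour, so `diag` forces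
  -- the new midpoint to be `u′`.
  ... | w′ , u′w′≡ , _ with diag u u′ w′ (sym u′w′≡)
  ...   | refl = sym u′w′≡

  target : ∀ {u v u′ v′} → col u v ≡ col u′ v′ → col v v ≡ col v′ v′
  target uv≡ = source (transp _ _ _ _ uv≡)

  diagonal-isFiber : ∀ u → IsFiber C (col u u)
  diagonal-isFiber u v w vw≡uu = diag u v w (sym vw≡uu)

  fiber-point : ∀ {X} → IsFiber C X → ∃ λ u → col u u ≡ X
  fiber-point {X} fibX with nonempty X
  ... | u , v , uv≡X = u , trans (cong (col u) (fibX u v uv≡X)) uv≡X

  col-inRel : ∀ {u v X Y} → col u u ≡ X → col v v ≡ Y → InRel C X Y (col u v)
  col-inRel u∈X v∈Y a b ab≡uv = trans (source ab≡uv) u∈X , trans (target ab≡uv) v∈Y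

  outdeg-pos : ∀ {X Y j x} → InRel C X Y j → col x x ≡ X → 0 < outdeg C j x
  outdeg-pos {j = j} {x} rel x∈X with nonempty j
  ... | a , b , ab≡j with transport-path (trans (proj₁ (rel a b ab≡j)) (sym x∈X)) b
  ...   | y , xy≡ab , _ = count-pos (λ y → col x y ≟ j) (y , trans xy≡ab ab≡j)

  -- The outdegree is an intersection number at the loop of a point: the number of ways to leave
  -- along `j` and return along its transpose `col b a`.
  outdeg-const : ∀ j {x x′} → col x x ≡ col x′ x′ → outdeg C j x ≡ outdeg C j x′
  outdeg-const j {x} {x′} xx≡ with nonempty j
  ... | a , b , ab≡j = trans (restrict x) (trans (coherent j (col b a) x x x′ x′ xx≡) (sym (restrict x′)))
    where
    restrict : ∀ z → outdeg C j z ≡ count (λ w → (col z w ≟ j) ×-dec (col w z ≟ col b a))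
    restrict z = count-cong (λ w → col z w ≟ j) (λ w → (col z w ≟ j) ×-dec (col w z ≟ col b a))
      ((λ zw≡j → zw≡j , transp _ _ _ _ (trans zw≡j (sym ab≡j))) , proj₁)

  indeg≡outdeg-transpose : ∀ a b y → indeg C (col a b) y ≡ outdeg C (col b a) y
  indeg≡outdeg-transpose a b y = count-cong (λ x → col x y ≟ col a b) (λ x → col y x ≟ col b a)
    (transp _ _ _ _ , transp _ _ _ _)

  indeg-const : ∀ j {y y′} → col y y ≡ col y′ y′ → indeg C j y ≡ indeg C j y′
  indeg-const j {y} {y′} yy≡ with nonempty j
  ... | a , b , refl = trans (indeg≡outdeg-transpose a b y)
                      (trans (outdeg-const (col b a) yy≡) (sym (indeg≡outdeg-transpose a b y′)))

  indeg-neighbour : ∀ {X Y j y} → InRel C X Y j → col y y ≡ Y → ∃ λ x → col x y ≡ j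
  indeg-neighbour {j = j} rel y∈Y with nonempty j
  ... | a , b , ab≡j with transport-path (trans (proj₂ (rel a b ab≡j)) (sym y∈Y)) a
  ...   | x , _ , xy≡ab = x , trans xy≡ab ab≡j

  -- The neighbourhoods of `x` under the relations from `X` to `Y` partition `Y`: each `y` lies in
  -- exactly one, that of colour `col x y`.
  outdeg-sum : ∀ {X Y x} → col x x ≡ X →
    ∑∈ (inRel? C X Y) (λ j → outdeg C j x) ≡ count (λ y → col y y ≟ Y)
  outdeg-sum {X} {Y} {x} x∈X = begin
    ∑∈ (inRel? C X Y) (λ j → outdeg C j x)
      ≡⟨ ≤-antisym (∑∈-mono-≤ (inRel? C X Y) (λ j rel → ≤-reflexive (restrict j rel)))
                   (∑∈-mono-≤ (inRel? C X Y) (λ j rel → ≤-reflexive (sym (restrict j rel)))) ⟩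
    ∑∈ (inRel? C X Y) (λ j → count (λ y → (col y y ≟ Y) ×-dec (col x y ≟ j)))
      ≡⟨ ∑∈-swap (inRel? C X Y) (λ y → col y y ≟ Y) (λ j y → col x y ≟ j) ⟩
    ∑∈ (λ y → col y y ≟ Y) (λ y → count (λ j → inRel? C X Y j ×-dec (col x y ≟ j)))
      ≡⟨ ∑∈-≡ (λ y → col y y ≟ Y) single ⟩
    count (λ y → col y y ≟ Y) * 1
      ≡⟨ *-identityʳ _ ⟩
    count (λ y → col y y ≟ Y) ∎
    where
    open ≡-Reasoning
    restrict : ∀ j → InRel C X Y j → outdeg C j x ≡ count (λ y → (col y y ≟ Y) ×-dec (col x y ≟ j))
    restrict j rel = count-cong (λ y → col x y ≟ j) (λ y → (col y y ≟ Y) ×-dec (col x y ≟ j))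
      ((λ xy≡j → proj₂ (rel x _ xy≡j) , xy≡j) , proj₂)
    single : ∀ y → col y y ≡ Y → count (λ j → inRel? C X Y j ×-dec (col x y ≟ j)) ≡ 1
    single y y∈Y = ≤-antisym
      (count≤1 (λ j → inRel? C X Y j ×-dec (col x y ≟ j)) λ i j (_ , xy≡i) (_ , xy≡j) → trans (sym xy≡i) xy≡j)
      (count-pos (λ j → inRel? C X Y j ×-dec (col x y ≟ j)) (col x y , col-inRel x∈X y∈Y , refl))

  -- Counting the pairs of `j` from both sides gives |X| times the outdegree equal to |Y| times the
  -- indegree; the common nonzero size cancels.
  outdeg≡indeg : ∀ {X Y j x y} → count (λ u → col u u ≟ X) ≡ count (λ u → col u u ≟ Y) →
    InRel C X Y j → col x x ≡ X → col y y ≡ Y → outdeg C j x ≡ indeg C j y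
  outdeg≡indeg {X} {Y} {j} {x} {y} #X≡#Y rel x∈X y∈Y =
    *-cancelˡ-≡ _ _ (count X?) {{>-nonZero (count-pos X? (x , x∈X))}}
      (trans (double-count X? Y? (λ a b → col a b ≟ j) rows columns) (cong (_* indeg C j y) (sym #X≡#Y)))
    where
    X? = λ u → col u u ≟ X
    Y? = λ u → col u u ≟ Y
    rows : ∀ a → col a a ≡ X → count (λ b → Y? b ×-dec (col a b ≟ j)) ≡ outdeg C j x
    rows a a∈X = trans
      (count-cong (λ b → Y? b ×-dec (col a b ≟ j)) (λ b → col a b ≟ j)
        (proj₂ , λ ab≡j → proj₂ (rel a _ ab≡j) , ab≡j))
      (outdeg-const j (trans a∈X (sym x∈X)))
    columns : ∀ b → col b b ≡ Y → count (λ a → X? a ×-dec (col a b ≟ j)) ≡ indeg C j y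
    columns b b∈Y = trans
      (count-cong (λ a → X? a ×-dec (col a b ≟ j)) (λ a → col a b ≟ j)
        (proj₂ , λ ab≡j → proj₁ (rel _ b ab≡j) , ab≡j))
      (indeg-const j (trans b∈Y (sym y∈Y)))

  -- With R = col x y, T = col x x′ and V = col x′ y, this is  d_T |xR ∩ x′V| = d_R c  for
  -- an intersection number c.
  triangle-count : ∀ x x′ y → ∃ λ c →
    outdeg C (col x x′) x * count (λ w → (col x w ≟ col x y) ×-dec (col w x′ ≟ col y x′))
      ≡ outdeg C (col x y) x * c
  triangle-count x x′ y = _ ,
    -- The pairs counted are `(z , w)` with z in xT, w in xR and (z,w) in V. Row and column counts
    -- are intersection numbers of T and of R, hence constant.
    double-count (λ z → col x z ≟ col x x′) (λ w → col x w ≟ col x y) (λ z w → col z w ≟ col x′ y)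
      rows columns
    where
    rows : ∀ z → col x z ≡ col x x′ →
      count (λ w → (col x w ≟ col x y) ×-dec (col z w ≟ col x′ y))
        ≡ count (λ w → (col x w ≟ col x y) ×-dec (col w x′ ≟ col y x′))
    rows z xz≡ = trans
      (count-cong (λ w → (col x w ≟ col x y) ×-dec (col z w ≟ col x′ y))
                  (λ w → (col x w ≟ col x y) ×-dec (col w z ≟ col y x′))
        ((λ (xw≡ , zw≡) → xw≡ , transp _ _ _ _ zw≡) , λ (xw≡ , wz≡) → xw≡ , transp _ _ _ _ wz≡))
      (coherent (col x y) (col y x′) x z x x′ xz≡)
    columns : ∀ w → col x w ≡ col x y →
      count (λ z → (col x z ≟ col x x′) ×-dec (col z w ≟ col x′ y))
        ≡ count (λ z → (col x z ≟ col x x′) ×-dec (col z y ≟ col x′ y))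
    columns w xw≡ = coherent (col x x′) (col x′ y) x w x y xw≡

  -- Relations of degree prime to p out of a p-valenced fiber

  module _ {p X} (pp : Prime p) (valenced : Valenced C p X) where

    -- The R-neighbours of `x` that `x′` sees in the same colour as `y` form a set `I`, whose size
    -- is divisible by the degree of R. Since `I` contains `y` and lies in xR, it is all of xR.
    coprime-degree⇒indistinguishable : ∀ {x x′ y w} → col x x ≡ X → col x′ x′ ≡ X →
      ¬ p ∣ outdeg C (col x y) x → col x w ≡ col x y → col x′ w ≡ col x′ y
    coprime-degree⇒indistinguishable {x} {x′} {y} {w} x∈X x′∈X p∤d xw≡xy
      with triangle-count x x′ y | valenced (col x x′) (col-inRel x∈X x′∈X) x x∈X
    ... | c , d*I≡d′*c | e , d≡pᵉ =
      transp _ _ _ _ (proj₂ (count-≤⇒⊇ I? R? proj₁ (∣⇒≤ {{>-nonZero (count-pos I? (y , refl , refl))}} d∣I) xw≡xy))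
      where
      I? = λ w → (col x w ≟ col x y) ×-dec (col w x′ ≟ col y x′)
      R? = λ w → col x w ≟ col x y
      d∣I : outdeg C (col x y) x ∣ count I?
      d∣I = coprime-prime-power pp p∤d e
        (divides c (trans (cong (_* count I?) (sym d≡pᵉ)) (trans d*I≡d′*c (*-comm _ c))))

    coprime-degree⇒outdeg≡1 : ∀ {Y x y} → col x x ≡ X → col y y ≡ Y →
      count (inRel? C X X) ≡ count (inRel? C X Y) →
      count (λ u → col u u ≟ X) ≡ count (λ u → col u u ≟ Y) →
      ¬ p ∣ outdeg C (col x y) x → outdeg C (col x y) x ≡ 1
    coprime-degree⇒outdeg≡1 {Y} {x} {y} x∈X y∈Y #XX≡#XY #X≡#Y p∤d = trans
      -- The fibers have equal size, so it suffices that `y` has a single R-neighbour in `X`.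
      (outdeg≡indeg #X≡#Y R∈XY x∈X y∈Y)
      (≤-antisym
        (count≤1 (λ a → col a y ≟ col x y) injective)
        (count-pos (λ a → col a y ≟ col x y) (x , refl)))
      where
      R∈XY : InRel C X Y (col x y)
      R∈XY = col-inRel x∈X y∈Y
      -- The relation V occurs in the complex product T R, with R = `col x y`. By coherence one
      -- triangle is enough to witness this.
      Product : Fin k → Fin k → Set
      Product T V = ∃ λ a → ∃ λ a′ → ∃ λ b → col a a′ ≡ T × col a b ≡ V × col a′ b ≡ col x y
      product? : ∀ T V → Dec (Product T V)
      product? T V = any? λ a → any? λ a′ → any? λ b →
        (col a a′ ≟ T) ×-dec (col a b ≟ V) ×-dec (col a′ b ≟ col x y)
      onto : ∀ V → InRel C X Y V → ∃ λ T → InRel C X X T × Product T V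
      onto V V∈XY with nonempty V
      ... | a , b , ab≡V with V∈XY a b ab≡V
      ...   | a∈X , b∈Y with indeg-neighbour R∈XY b∈Y
      ...     | a′ , a′b≡R = col a a′ , col-inRel a∈X (proj₁ (R∈XY a′ b a′b≡R)) , a , a′ , b , refl , ab≡V , a′b≡R
      functional : ∀ T V V′ → InRel C X X T → Product T V → Product T V′ → V ≡ V′
      functional T V V′ T∈XX (a , a′ , b , aa′≡T , ab≡V , a′b≡R) (c , c′ , d , cc′≡T , cd≡V′ , c′d≡R)
        -- Moving the first triangle onto the edge `(c , c′)` gives a point `w`. Both `w` and `d`
        -- are R-neighbours of `c′`, so `c` sees them in the same colour.
        with transport-path (trans aa′≡T (sym cc′≡T)) b
      ... | w , cw≡ab , wc′≡ba′ = begin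
        V        ≡⟨ ab≡V ⟨
        col a b  ≡⟨ cw≡ab ⟨
        col c w  ≡⟨ coprime-degree⇒indistinguishable (proj₂ (T∈XX c c′ cc′≡T)) (proj₁ (T∈XX c c′ cc′≡T)) p∤d′
                      (trans (transp _ _ _ _ wc′≡ba′) (trans a′b≡R (sym c′d≡R))) ⟩
        col c d  ≡⟨ cd≡V′ ⟩
        V′       ∎
        where
        open ≡-Reasoning
        p∤d′ : ¬ p ∣ outdeg C (col c′ d) c′
        p∤d′ = subst (λ n → ¬ p ∣ n)
          (trans (outdeg-const (col x y) (source (sym c′d≡R))) (cong (λ j → outdeg C j c′) (sym c′d≡R))) p∤d
      injective : ∀ a a′ → col a y ≡ col x y → col a′ y ≡ col x y → a ≡ a′
      injective a a′ ay≡R a′y≡R = diag a a a′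
        -- The relations `col a a` and `col a a′` both have product R with R, so they coincide, and
        -- `diag` gives a = a′.
        (surjective⇒injective (inRel? C X X) (inRel? C X Y) product? #XX≡#XY onto functional
          (col a a) (col a a′) (col x y) (col-inRel a∈X a∈X) (col-inRel a∈X a′∈X)
          (a , a , y , refl , ay≡R , ay≡R) (a , a′ , y , refl , ay≡R , a′y≡R))
        where
        a∈X = proj₁ (R∈XY a y ay≡R)
        a′∈X = proj₁ (R∈XY a′ y a′y≡R)

-- Equality of fibers in a reduced scheme

module _ (C : Scheme) {m n r} (mnr : IsMNR C m n r) (reduced : Reduced C) where
  open Scheme C

  private
    #R : ∀ {X Y} → IsFiber C X → IsFiber C Y → count (inRel? C X Y) ≡ r
    #R = proj₁ mnr _ _
    #X : ∀ {X} → IsFiber C X → count (λ u → col u u ≟ X) ≡ m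
    #X = proj₁ (proj₂ mnr) _

  -- Degree 1 at one point spreads over `X`, and equal fiber sizes carry it to indegrees on `Y`; so
  -- `j` is thin and reducedness applies.
  outdeg≡1⇒≡ : ∀ {X Y j x} → IsFiber C X → IsFiber C Y → InRel C X Y j → col x x ≡ X →
    outdeg C j x ≡ 1 → X ≡ Y
  outdeg≡1⇒≡ {X} {Y} {j} {x} fibX fibY rel x∈X d≡1 = reduced X Y fibX fibY
    (j , rel , (λ z z∈X → trans (outdeg-const C j (trans z∈X (sym x∈X))) d≡1)
             , λ y y∈Y → trans (sym (outdeg≡indeg C (trans (#X fibX) (sym (#X fibY))) rel x∈X y∈Y)) d≡1)

  unique-fiber⇒n≡1 : ∀ {X} → IsFiber C X → (∀ Y → IsFiber C Y → X ≡ Y) → n ≡ 1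
  unique-fiber⇒n≡1 {X} fibX unique = trans (sym (proj₂ (proj₂ mnr)))
    (≤-antisym (count≤1 (isFiber? C) λ Y Z fibY fibZ → trans (sym (unique Y fibY)) (unique Z fibZ))
               (count-pos (isFiber? C) (X , fibX)))

  m<2r⇒≡ : m < 2 * r → ∀ {X Y} → IsFiber C X → IsFiber C Y → X ≡ Y
  m<2r⇒≡ m<2r {X} {Y} fibX fibY = decidable-stable (X ≟ Y) λ X≢Y →
    let x , x∈X = fiber-point C fibX
        2≤d : ∀ j → InRel C X Y j → 2 ≤ outdeg C j x
        -- The degree is positive, and it is not 1, since that would force X = Y.
        2≤d j rel = ≤∧≢⇒< (outdeg-pos C rel x∈X) (X≢Y ∘ outdeg≡1⇒≡ fibX fibY rel x∈X ∘ sym)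
    in <⇒≱ m<2r (begin
         2 * r                                   ≡⟨ *-comm 2 r ⟩
         r * 2                                   ≡⟨ cong (_* 2) (#R fibX fibY) ⟨
         count (inRel? C X Y) * 2                ≡⟨ ∑∈-const (inRel? C X Y) 2 ⟨
         ∑∈ (inRel? C X Y) (λ _ → 2)             ≤⟨ ∑∈-mono-≤ (inRel? C X Y) 2≤d ⟩
         ∑∈ (inRel? C X Y) (λ j → outdeg C j x)  ≡⟨ outdeg-sum C x∈X ⟩
         count (λ y → col y y ≟ Y)               ≡⟨ #X fibY ⟩
         m                                       ∎)
    where open ≤-Reasoning

  valenced⇒≡ : ∀ {p X Y} → Prime p → ¬ p ∣ m → Valenced C p X → IsFiber C X → IsFiber C Y → X ≡ Y
  valenced⇒≡ {p} {X} {Y} pp p∤m valenced fibX fibY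
    with x , x∈X ← fiber-point C fibX
    -- If `p` divided every degree from `X` to `Y`, it would divide their sum `m`.
    with ¬∀⟶∃¬ k (λ j → InRel C X Y j → p ∣ outdeg C j x)
           (λ j → inRel? C X Y j →-dec (p ∣? outdeg C j x))
           (λ p∣d → p∤m (subst (p ∣_) (trans (outdeg-sum C x∈X) (#X fibY)) (∣-∑∈ (inRel? C X Y) p∣d)))
  ... | j , ¬p∣d with inRel? C X Y j
  -- For `j` outside these relations the implication holds vacuously, so `j` cannot be the
  -- counterexample.
  ...   | no ¬rel = contradiction (λ rel → contradiction rel ¬rel) ¬p∣d
  ...   | yes rel with count-pos⁻¹ (λ y → col x y ≟ j) (outdeg-pos C rel x∈X)
  -- A neighbour `y` along `j` puts the relation in the form `col x y`.
  ...     | y , refl = outdeg≡1⇒≡ fibX fibY rel x∈X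
    (coprime-degree⇒outdeg≡1 C pp valenced x∈X (proj₂ (rel x y refl))
      (trans (#R fibX fibX) (sym (#R fibX fibY))) (trans (#X fibX) (sym (#X fibY))) (λ p∣d → ¬p∣d λ _ → p∣d))

theorem3 : (C : Scheme) → 0 < Scheme.N C → (m n r : ℕ) → IsMNR C m n r → Reduced C →
    (p : ℕ) → Prime p →
    (m < 2 * r → n ≡ 1)
    × (¬ (p ∣ m) → (∃ λ X → IsFiber C X × Valenced C p X) → n ≡ 1)
theorem3 C 0<N m n r mnr reduced p pp =
    (λ m<2r → unique-fiber⇒n≡1 C mnr reduced fib₀ λ _ → m<2r⇒≡ C mnr reduced m<2r fib₀)
  , λ p∤m (X , fibX , valenced) →
      unique-fiber⇒n≡1 C mnr reduced fibX λ _ → valenced⇒≡ C mnr reduced pp p∤m valenced fibX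
  where
  -- Part (i) names no fiber, so one is taken through a point of the nonempty set V.
  fib₀ = diagonal-isFiber C (fromℕ< 0<N)
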